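{- Let $\Sigma_n$ be an empty signature with sorts $S=\{\sigma_1,\dots,\sigma_n\}$, let $\Sigma^n_s$ be the signature with sorts $S$ and a single function symbol $s$ of arity $\sigma_1\to\sigma_1$, let $\mathcal{T}$ be a $\Sigma_n$-theory, and let $\mathcal{T}'$ be the $\Sigma^n_s$-theory axiomatized by $Ax(\mathcal{T})\cup\{\forall x.\,s(x)=x\}$, where $x$ is a variable of sort $\sigma_1$. Then $\mathcal{T}$ has the finite model property with respect to $S$ iff $\mathcal{T}'$ has the finite model property with respect to $S$; and $\mathcal{T}$ is stably finite with respect to $S$ iff $\mathcal{T}'$ is stably finite with respect to $S$.
   Context: An empty signature has no function symbols and only equality predicates (interpreted as identity). A $\Sigma$-interpretation is a structure (nonempty domain $\tau^{\mathcal{A}}$ per sort $\tau$) plus values for variables; a $\Sigma$-theory $\mathcal{T}$ is the class of all $\Sigma$-interpretations satisfying a set $Ax(\mathcal{T})$ of closed formulas (its $\mathcal{T}$-interpretations); $\mathcal{T}$-satisfiable means satisfied by some $\mathcal{T}$-interpretation. Finite model property w.r.t. $S$: every $\mathcal{T}$-satisfiable quantifier-free formula is satisfied by a $\mathcal{T}$-interpretation $\mathcal{A}$ with $\tau^{\mathcal{A}}$ finite for each $\tau\in S$. Stably finite w.r.t. $S$: for every quantifier-free $\phi$ and $\mathcal{T}$-interpretation $\mathcal{A}$ satisfying $\phi$, some $\mathcal{T}$-interpretation $\mathcal{B}$ satisfies $\phi$ with $|\tau^{\mathcal{B}}|$ finite and $|\tau^{\mathcal{B}}|\le|\tau^{\mathcal{A}}|$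 for each $\tau\in S$. -}

module Defs where

open import Data.Empty using (⊥)
open import Data.Fin.Base using (Fin; zero)
import Data.Fin.Properties as Fin
open import Data.List.Base using (List; []; _∷_)
open import Data.List.Relation.Unary.All using (All; []; _∷_)
open import Data.Nat.Base using (ℕ; suc)
import Data.Nat.Properties as ℕ
open import Data.Product.Base using (_×_; _,_; ∃-syntax)
open import Data.Sum.Base using (_⊎_; inj₁; inj₂)
open import Data.Unit.Base using (⊤; tt)
open import Function.Bundles using (_↔_; _↣_)
open import Level using (Level; _⊔_; 0ℓ) renaming (suc to lsuc)
open import Relation.Binary.Definitions using (DecidableEquality)
open import Relation.Binary.PropositionalEquality using (_≡_; _≢_; refl)
open import Relation.Nullary.Decidable using (yes; no)
open import Relation.Nullary.Negation using (¬_)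
open import Relation.Unary using (Pred; _∈_)

-- Equality on each sort is a logical symbol of every formula, so Rel lists
-- only the predicate symbols other than equality.
record Signature : Set₁ where
  field
    Sort  : Set
    _≟_   : DecidableEquality Sort
    Func  : Set
    dom   : Func → List Sort
    cod   : Func → Sort
    Rel   : Set
    arity : Rel → List Sort

open Signature public using (Sort)

module _ (Σ : Signature) where
  open Signature Σ hiding (Sort)

  -- The variables of each sort are indexed by ℕ.
  data Term : Sort Σ → Set where
    var : ∀ {σ} → ℕ → Term σ
    app : (f : Func) → All Term (dom f) → Term (cod f)

  infix  8 _≐_
  infix  7 ¬′_
  infixr 6 _∧′_
  infixr 5 _∨′_
  infixr 4 _⇒′_

  data Formula : Set where
    _≐_             : ∀ {σ} → Term σ → Term σ → Formula
    rel             : (r : Rel) → All Term (arity r) → Formula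
    ¬′_             : Formula → Formula
    _∧′_ _∨′_ _⇒′_  : Formula → Formula → Formula
    ∀′ ∃′           : (σ : Sort Σ) → ℕ → Formula → Formula

  Var : Set
  Var = Sort Σ × ℕ

module _ {Σ : Signature} where
  open Signature Σ hiding (Sort)

  data QuantifierFree : Pred (Formula Σ) 0ℓ where
    _≐_  : ∀ {σ} (t u : Term Σ σ) → QuantifierFree (t ≐ u)
    rel  : ∀ r ts → QuantifierFree (rel r ts)
    ¬′_  : ∀ {φ} → QuantifierFree φ → QuantifierFree (¬′ φ)
    _∧′_ : ∀ {φ ψ} → QuantifierFree φ → QuantifierFree ψ → QuantifierFree (φ ∧′ ψ)
    _∨′_ : ∀ {φ ψ} → QuantifierFree φ → QuantifierFree ψ → QuantifierFree (φ ∨′ ψ)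
    _⇒′_ : ∀ {φ ψ} → QuantifierFree φ → QuantifierFree ψ → QuantifierFree (φ ⇒′ ψ)

  mutual
    OccursIn : ∀ {σ} → Var Σ → Term Σ σ → Set
    OccursIn x (var {σ} k) = x ≡ (σ , k)
    OccursIn x (app f ts)  = OccursInAny x ts

    OccursInAny : ∀ {σs} → Var Σ → All (Term Σ) σs → Set
    OccursInAny x []       = ⊥
    OccursInAny x (t ∷ ts) = OccursIn x t ⊎ OccursInAny x ts

  FreeIn : Var Σ → Formula Σ → Set
  FreeIn x (t ≐ u)    = OccursIn x t ⊎ OccursIn x u
  FreeIn x (rel r ts) = OccursInAny x ts
  FreeIn x (¬′ φ)     = FreeIn x φ
  FreeIn x (φ ∧′ ψ)   = FreeIn x φ ⊎ FreeIn x ψ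
  FreeIn x (φ ∨′ ψ)   = FreeIn x φ ⊎ FreeIn x ψ
  FreeIn x (φ ⇒′ ψ)   = FreeIn x φ ⊎ FreeIn x ψ
  FreeIn x (∀′ σ k φ) = x ≢ (σ , k) × FreeIn x φ
  FreeIn x (∃′ σ k φ) = x ≢ (σ , k) × FreeIn x φ

  Closed : Pred (Formula Σ) 0ℓ
  Closed φ = ∀ x → ¬ FreeIn x φ

module _ (Σ : Signature) (ℓ : Level) where
  open Signature Σ hiding (Sort)

  record Structure : Set (lsuc ℓ) where
    field
      Domain   : Sort Σ → Set ℓ
      nonempty : ∀ σ → Domain σ
      ⟦_⟧ᶠ     : ∀ f → All Domain (dom f) → Domain (cod f)
      ⟦_⟧ʳ     : ∀ r → Pred (All Domain (arity r)) ℓ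

    Valuation : Set ℓ
    Valuation = ∀ σ → ℕ → Domain σ

  record Interpretation : Set (lsuc ℓ) where
    field
      structure : Structure
    open Structure structure public
    field
      valuation : Valuation

module _ {Σ : Signature} {ℓ : Level} where
  open Signature Σ hiding (Sort)

  module _ (M : Structure Σ ℓ) where
    open Structure M

    _[_,_↦_] : Valuation → (σ : Sort Σ) → ℕ → Domain σ → Valuation
    (ν [ σ , k ↦ a ]) τ j with σ ≟ τ | k ℕ.≟ j
    ... | yes refl | yes _ = a
    ... | yes _    | no _  = ν τ j
    ... | no _     | _     = ν τ j

    mutual
      eval : ∀ {σ} → Valuation → Term Σ σ → Domain σ
      eval ν (var {σ} k) = ν σ k
      eval ν (app f ts)  = ⟦ f ⟧ᶠ (evals ν ts)

      evals : ∀ {σs} → Valuation → All (Term Σ) σs → All Domain σs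
      evals ν []       = []
      evals ν (t ∷ ts) = eval ν t ∷ evals ν ts

    Holds : Valuation → Pred (Formula Σ) ℓ
    Holds ν (t ≐ u)    = eval ν t ≡ eval ν u
    Holds ν (rel r ts) = ⟦ r ⟧ʳ (evals ν ts)
    Holds ν (¬′ φ)     = ¬ Holds ν φ
    Holds ν (φ ∧′ ψ)   = Holds ν φ × Holds ν ψ
    Holds ν (φ ∨′ ψ)   = Holds ν φ ⊎ Holds ν ψ
    Holds ν (φ ⇒′ ψ)   = Holds ν φ → Holds ν ψ
    Holds ν (∀′ σ k φ) = ∀ (a : Domain σ) → Holds (ν [ σ , k ↦ a ]) φ
    Holds ν (∃′ σ k φ) = ∃[ a ] Holds (ν [ σ , k ↦ a ]) φ

  infix 4 _⊨_

  _⊨_ : Interpretation Σ ℓ → Pred (Formula Σ) ℓ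
  A ⊨ φ = Holds structure valuation φ
    where open Interpretation A

record Theory (Σ : Signature) (a : Level) : Set (lsuc a) where
  field
    Ax     : Pred (Formula Σ) a
    closed : ∀ {φ} → φ ∈ Ax → Closed φ

Finite : ∀ {ℓ} → Pred (Set ℓ) ℓ
Finite D = ∃[ k ] D ↔ Fin k

module _ {Σ : Signature} {a : Level} (ℓ : Level) (T : Theory Σ a) where
  open Theory T
  open Interpretation using (Domain)

  IsModel : Pred (Interpretation Σ ℓ) (a ⊔ ℓ)
  IsModel A = ∀ {φ} → φ ∈ Ax → A ⊨ φ

  Satisfiable : Pred (Formula Σ) (a ⊔ lsuc ℓ)
  Satisfiable φ = ∃[ A ] IsModel A × A ⊨ φ

  FiniteModelProperty : Pred (Sort Σ) 0ℓ → Set (a ⊔ lsuc ℓ)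
  FiniteModelProperty S =
    ∀ φ → QuantifierFree φ → Satisfiable φ →
    ∃[ A ] IsModel A × A ⊨ φ × (∀ τ → τ ∈ S → Finite (Domain A τ))

  -- |τᴮ| ≤ |τᴬ| means that some injection τᴮ → τᴬ exists.
  StablyFinite : Pred (Sort Σ) 0ℓ → Set (a ⊔ lsuc ℓ)
  StablyFinite S =
    ∀ φ → QuantifierFree φ → ∀ A → IsModel A → A ⊨ φ →
    ∃[ B ] IsModel B × B ⊨ φ ×
      (∀ τ → τ ∈ S → Finite (Domain B τ) × (Domain B τ ↣ Domain A τ))

emptySignature : ℕ → Signature
emptySignature n = record
  { Sort  = Fin n
  ; _≟_   = Fin._≟_
  ; Func  = ⊥
  ; dom   = λ ()
  ; cod   = λ ()
  ; Rel   = ⊥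
  ; arity = λ ()
  }

-- Only signatures with at least one sort have a sort σ₁, so m counts the sorts
-- other than σ₁.
unarySignature : ℕ → Signature
unarySignature m = record
  { Sort  = Fin (suc m)
  ; _≟_   = Fin._≟_
  ; Func  = ⊤
  ; dom   = λ _ → zero ∷ []
  ; cod   = λ _ → zero
  ; Rel   = ⊥
  ; arity = λ ()
  }

module _ {m : ℕ} where
  private
    Σₙ = emptySignature (suc m)
    Σₛ = unarySignature m

  σ₁ : Fin (suc m)
  σ₁ = zero

  s : Term Σₛ σ₁ → Term Σₛ σ₁
  s t = app tt (t ∷ [])

  embedTerm : ∀ {σ} → Term Σₙ σ → Term Σₛ σ
  embedTerm (var k) = var k

  embed : Formula Σₙ → Formula Σₛ
  embed (t ≐ u)    = embedTerm t ≐ embedTerm u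
  embed (¬′ φ)     = ¬′ embed φ
  embed (φ ∧′ ψ)   = embed φ ∧′ embed ψ
  embed (φ ∨′ ψ)   = embed φ ∨′ embed ψ
  embed (φ ⇒′ ψ)   = embed φ ⇒′ embed ψ
  embed (∀′ σ k φ) = ∀′ σ k (embed φ)
  embed (∃′ σ k φ) = ∃′ σ k (embed φ)

  s-identity : ℕ → Formula Σₛ
  s-identity x = ∀′ σ₁ x (s (var x) ≐ var x)

  private
    occursIn-embedTerm : ∀ {σ} x (t : Term Σₙ σ) →
                         OccursIn x (embedTerm t) → OccursIn x t
    occursIn-embedTerm x (var k) p = p

    freeIn-embed : ∀ x φ → FreeIn x (embed φ) → FreeIn x φ
    freeIn-embed x (t ≐ u) (inj₁ p)    = inj₁ (occursIn-embedTerm x t p)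
    freeIn-embed x (t ≐ u) (inj₂ p)    = inj₂ (occursIn-embedTerm x u p)
    freeIn-embed x (¬′ φ) p            = freeIn-embed x φ p
    freeIn-embed x (φ ∧′ ψ) (inj₁ p)   = inj₁ (freeIn-embed x φ p)
    freeIn-embed x (φ ∧′ ψ) (inj₂ p)   = inj₂ (freeIn-embed x ψ p)
    freeIn-embed x (φ ∨′ ψ) (inj₁ p)   = inj₁ (freeIn-embed x φ p)
    freeIn-embed x (φ ∨′ ψ) (inj₂ p)   = inj₂ (freeIn-embed x ψ p)
    freeIn-embed x (φ ⇒′ ψ) (inj₁ p)   = inj₁ (freeIn-embed x φ p)
    freeIn-embed x (φ ⇒′ ψ) (inj₂ p)   = inj₂ (freeIn-embed x ψ p)
    freeIn-embed x (∀′ σ k φ) (x≢ , p) = x≢ , freeIn-embed x φ p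
    freeIn-embed x (∃′ σ k φ) (x≢ , p) = x≢ , freeIn-embed x φ p

    s-identity-closed : ∀ x → Closed (s-identity x)
    s-identity-closed x y (y≢x , inj₁ (inj₁ y≡x)) = y≢x y≡x
    s-identity-closed x y (y≢x , inj₂ y≡x)        = y≢x y≡x

  -- x is the index, among the variables of sort σ₁, of the bound variable
  -- of the added axiom.
  addIdentity : ∀ {a} → ℕ → Theory Σₙ a → Theory Σₛ a
  addIdentity x T = record
    { Ax     = λ ψ → (∃[ φ ] φ ∈ Ax × ψ ≡ embed φ) ⊎ ψ ≡ s-identity x
    ; closed = λ where
        (inj₁ (φ , φ∈Ax , refl)) y p → closed φ∈Ax y (freeIn-embed y φ p)
        (inj₂ refl)                  → s-identity-closed x
    }
    where open Theory T

module Submission where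

open import Defs
open import Data.Fin.Base using (Fin)
import Data.Fin.Properties as Fin
open import Data.List.Relation.Unary.All using (All; []; _∷_)
open import Data.Nat.Base using (ℕ; suc)
import Data.Nat.Properties as ℕ
open import Data.Product.Base using (_×_; _,_; map₂)
open import Data.Product.Function.NonDependent.Propositional using (_×-⇔_)
open import Data.Sum.Base using (inj₁; inj₂)
open import Data.Sum.Function.Propositional using (_⊎-⇔_)
open import Data.Unit.Base using (tt)
open import Function.Bundles using (_⇔_; mk⇔; Equivalence)
open import Function.Related.TypeIsomorphisms using (→-cong-⇔; ¬-cong-⇔)
open import Level using (Level) renaming (suc to lsuc)
open import Relation.Binary.PropositionalEquality
  using (_≡_; refl; sym; trans; cong; cong₂; subst)
open import Relation.Nullary.Decidable using (yes; no)
open import Relation.Nullary.Negation using (contradiction)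
open import Relation.Unary using (Pred; U)

open Equivalence using (to; from)

-- A model of ∀x. s(x) = x is a Σₙ-structure together with the identity
-- function, so passing between the two signatures changes no domain, and
-- deleting every occurrence of s from a formula preserves its truth value.

private
  variable
    a ℓ : Level
    m   : ℕ

stripTerm : ∀ {σ} → Term (unarySignature m) σ → Term (emptySignature (suc m)) σ
stripTerm (var k)          = var k
stripTerm (app _ (t ∷ [])) = stripTerm t

strip : Formula (unarySignature m) → Formula (emptySignature (suc m))
strip (t ≐ u)    = stripTerm t ≐ stripTerm u
strip (¬′ φ)     = ¬′ strip φ
strip (φ ∧′ ψ)   = strip φ ∧′ strip ψ
strip (φ ∨′ ψ)   = strip φ ∨′ strip ψ
strip (φ ⇒′ ψ)   = strip φ ⇒′ strip ψ
strip (∀′ σ k φ) = ∀′ σ k (strip φ)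
strip (∃′ σ k φ) = ∃′ σ k (strip φ)

strip-quantifierFree : ∀ {φ : Formula (unarySignature m)} →
                       QuantifierFree φ → QuantifierFree (strip φ)
strip-quantifierFree (t ≐ u)  = stripTerm t ≐ stripTerm u
strip-quantifierFree (¬′ p)   = ¬′ strip-quantifierFree p
strip-quantifierFree (p ∧′ q) = strip-quantifierFree p ∧′ strip-quantifierFree q
strip-quantifierFree (p ∨′ q) = strip-quantifierFree p ∨′ strip-quantifierFree q
strip-quantifierFree (p ⇒′ q) = strip-quantifierFree p ⇒′ strip-quantifierFree q

embed-quantifierFree : ∀ {φ : Formula (emptySignature (suc m))} →
                       QuantifierFree φ → QuantifierFree (embed φ)
embed-quantifierFree (t ≐ u)  = embedTerm t ≐ embedTerm u
embed-quantifierFree (¬′ p)   = ¬′ embed-quantifierFree p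
embed-quantifierFree (p ∧′ q) = embed-quantifierFree p ∧′ embed-quantifierFree q
embed-quantifierFree (p ∨′ q) = embed-quantifierFree p ∨′ embed-quantifierFree q
embed-quantifierFree (p ⇒′ q) = embed-quantifierFree p ⇒′ embed-quantifierFree q

stripTerm-embedTerm : ∀ {σ} (t : Term (emptySignature (suc m)) σ) →
                      stripTerm (embedTerm t) ≡ t
stripTerm-embedTerm (var k) = refl

-- With this equation `holds-embed` becomes an instance of `holds-strip`, so a single induction on
-- formulas serves both translations. The quantifier clauses matter for the axioms of `T`.
strip-embed : (φ : Formula (emptySignature (suc m))) → strip (embed φ) ≡ φ
strip-embed (t ≐ u)    = cong₂ _≐_ (stripTerm-embedTerm t) (stripTerm-embedTerm u)
strip-embed (¬′ φ)     = cong ¬′_ (strip-embed φ)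
strip-embed (φ ∧′ ψ)   = cong₂ _∧′_ (strip-embed φ) (strip-embed ψ)
strip-embed (φ ∨′ ψ)   = cong₂ _∨′_ (strip-embed φ) (strip-embed ψ)
strip-embed (φ ⇒′ ψ)   = cong₂ _⇒′_ (strip-embed φ) (strip-embed ψ)
strip-embed (∀′ σ k φ) = cong (∀′ σ k) (strip-embed φ)
strip-embed (∃′ σ k φ) = cong (∃′ σ k) (strip-embed φ)

InterpretsIdentity : Structure (unarySignature m) ℓ → Set ℓ
InterpretsIdentity N = ∀ d → ⟦ tt ⟧ᶠ (d ∷ []) ≡ d
  where open Structure N

-- The comparison of `σ₁` with itself computes, but `k ℕ.≟ k` is stuck for a variable `k` and has to
-- be matched.
update-same : (N : Structure (unarySignature m) ℓ) → let open Structure N in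
              ∀ (ν : ∀ σ → ℕ → Domain σ) k (d : Domain σ₁) →
              _[_,_↦_] N ν σ₁ k d σ₁ k ≡ d
update-same N ν k d with k ℕ.≟ k
... | yes _  = refl
... | no k≢k = contradiction refl k≢k

s-identity⇒interpretsIdentity : ∀ {x} (N : Structure (unarySignature m) ℓ) {ν} →
                                Holds N ν (s-identity x) → InterpretsIdentity N
s-identity⇒interpretsIdentity {x = x} N {ν} s≗id d =
  -- The axiom instantiated at `d` mentions the updated value of the variable `x` on both sides;
  -- `update-same` turns both occurrences into `d`.
  subst (λ e → ⟦ tt ⟧ᶠ (e ∷ []) ≡ e) (update-same N ν x d) (s≗id d)
  where open Structure N

FunctionsOn : (Σ : Signature) → (Sort Σ → Set ℓ) → Set ℓ
FunctionsOn Σ D = ∀ f → All D (dom f) → D (cod f)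
  where open Signature Σ

RelationsOn : (Σ : Signature) → (Sort Σ → Set ℓ) → Set (lsuc ℓ)
RelationsOn {ℓ} Σ D = ∀ r → Pred (All D (arity r)) ℓ
  where open Signature Σ

-- Taking the components apart lets N be an expansion of M whatever the
-- functions out of the empty type in M are: two of these need not be equal.
module _ {D : Fin (suc m) → Set ℓ} {d₀ : ∀ σ → D σ}
  {f₀ : FunctionsOn (emptySignature (suc m)) D} {r₀ : RelationsOn (emptySignature (suc m)) D}
  {f : FunctionsOn (unarySignature m) D} {r : RelationsOn (unarySignature m) D}
  where
  private
    M : Structure (emptySignature (suc m)) ℓ
    M = record { Domain = D ; nonempty = d₀ ; ⟦_⟧ᶠ = f₀ ; ⟦_⟧ʳ = r₀ }
    N : Structure (unarySignature m) ℓ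
    N = record { Domain = D ; nonempty = d₀ ; ⟦_⟧ᶠ = f ; ⟦_⟧ʳ = r }

  -- Both updates branch on the same comparisons of sorts and indices. The equality is kept
  -- pointwise, since identifying the updated valuations as functions would take function
  -- extensionality.
  update-cong : ∀ {μ ν : ∀ σ → ℕ → D σ} → (∀ σ k → μ σ k ≡ ν σ k) →
                ∀ τ j d σ k → _[_,_↦_] M μ τ j d σ k ≡ _[_,_↦_] N ν τ j d σ k
  update-cong μ≗ν τ j d σ k with τ Fin.≟ σ | j ℕ.≟ k
  ... | yes refl | yes _ = refl
  ... | yes refl | no _  = μ≗ν σ k
  ... | no _     | _     = μ≗ν σ k

  module _ (f-id : InterpretsIdentity N) where

    -- Each `s` removed from the term is paid for by one use of `f-id`, at the value of its
    -- argument.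
    eval-strip : ∀ {μ ν} → (∀ σ k → μ σ k ≡ ν σ k) → ∀ {σ} (t : Term (unarySignature m) σ) →
                 eval M μ (stripTerm t) ≡ eval N ν t
    eval-strip μ≗ν (var k)           = μ≗ν _ k
    eval-strip μ≗ν (app tt (t ∷ [])) = trans (eval-strip μ≗ν t) (sym (f-id _))

    -- Both directions are proved together because negations and premises of implications reverse
    -- them. Two pointwise equal valuations are needed to pass under a quantifier, where the same
    -- element of the shared `D` is used in `M` and in `N`.
    holds-strip-≗ : ∀ {μ ν} → (∀ σ k → μ σ k ≡ ν σ k) → ∀ φ →
                  Holds M μ (strip φ) ⇔ Holds N ν φ
    holds-strip-≗ μ≗ν (t ≐ u) = mk⇔
      (λ p → trans (sym (eval-strip μ≗ν t)) (trans p (eval-strip μ≗ν u)))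
      (λ p → trans (eval-strip μ≗ν t) (trans p (sym (eval-strip μ≗ν u))))
    holds-strip-≗ μ≗ν (¬′ φ)     = ¬-cong-⇔ (holds-strip-≗ μ≗ν φ)
    holds-strip-≗ μ≗ν (φ ∧′ ψ)   = holds-strip-≗ μ≗ν φ ×-⇔ holds-strip-≗ μ≗ν ψ
    holds-strip-≗ μ≗ν (φ ∨′ ψ)   = holds-strip-≗ μ≗ν φ ⊎-⇔ holds-strip-≗ μ≗ν ψ
    holds-strip-≗ μ≗ν (φ ⇒′ ψ)   = →-cong-⇔ (holds-strip-≗ μ≗ν φ) (holds-strip-≗ μ≗ν ψ)
    holds-strip-≗ μ≗ν (∀′ σ k φ) = mk⇔
      (λ p d → to (holds-strip-≗ (update-cong μ≗ν σ k d) φ) (p d))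
      (λ p d → from (holds-strip-≗ (update-cong μ≗ν σ k d) φ) (p d))
    holds-strip-≗ μ≗ν (∃′ σ k φ) = mk⇔
      (map₂ λ {d} → to (holds-strip-≗ (update-cong μ≗ν σ k d) φ))
      (map₂ λ {d} → from (holds-strip-≗ (update-cong μ≗ν σ k d) φ))

    holds-strip : ∀ {ν} φ → Holds M ν (strip φ) ⇔ Holds N ν φ
    holds-strip = holds-strip-≗ λ _ _ → refl

    holds-embed : ∀ {ν} φ → Holds M ν φ ⇔ Holds N ν (embed φ)
    holds-embed {ν} φ =
      subst (λ χ → Holds M ν χ ⇔ Holds N ν (embed φ)) (strip-embed φ) (holds-strip (embed φ))

reduct : Interpretation (unarySignature m) ℓ → Interpretation (emptySignature (suc m)) ℓ
reduct A = record
  { structure = record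
    { Domain = Domain ; nonempty = nonempty ; ⟦_⟧ᶠ = λ () ; ⟦_⟧ʳ = λ () }
  ; valuation = valuation
  }
  where open Interpretation A

expand : Interpretation (emptySignature (suc m)) ℓ → Interpretation (unarySignature m) ℓ
expand A = record
  { structure = record
    { Domain = Domain ; nonempty = nonempty ; ⟦_⟧ᶠ = λ { tt (d ∷ []) → d } ; ⟦_⟧ʳ = λ () }
  ; valuation = valuation
  }
  where open Interpretation A

module _ (x : ℕ) (T : Theory (emptySignature (suc m)) a) where
  private
    T′ = addIdentity x T

  interpretsIdentity : (A : Interpretation (unarySignature m) ℓ) → IsModel ℓ T′ A →
                       InterpretsIdentity (Interpretation.structure A)
  interpretsIdentity A A⊨T′ =
    s-identity⇒interpretsIdentity {x = x} (Interpretation.structure A) (A⊨T′ (inj₂ refl))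

  reduct-isModel : (A : Interpretation (unarySignature m) ℓ) →
                   IsModel ℓ T′ A → IsModel ℓ T (reduct A)
  reduct-isModel A A⊨T′ {φ} φ∈Ax =
    from (holds-embed (interpretsIdentity A A⊨T′) φ) (A⊨T′ (inj₁ (φ , φ∈Ax , refl)))

  expand-isModel : (A : Interpretation (emptySignature (suc m)) ℓ) →
                   IsModel ℓ T A → IsModel ℓ T′ (expand A)
  expand-isModel A A⊨T (inj₁ (φ , φ∈Ax , refl)) = to (holds-embed (λ _ → refl) φ) (A⊨T φ∈Ax)
  -- `s` is the identity of `expand A` by computation, so both sides reduce to the same lookup in
  -- the updated valuation.
  expand-isModel A A⊨T (inj₂ refl)              = λ _ → refl

  finiteModelProperty-expand : ∀ {S} → FiniteModelProperty ℓ T S → FiniteModelProperty ℓ T′ S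
  finiteModelProperty-expand fmp φ qf (A , A⊨T′ , A⊨φ) =
    let B , B⊨T , B⊨φ , fin = fmp (strip φ) (strip-quantifierFree qf)
          (reduct A , reduct-isModel A A⊨T′ , from (holds-strip (interpretsIdentity A A⊨T′) φ) A⊨φ)
    -- `fin` is reused as it stands: `expand B` has definitionally the domains of `B`.
    in expand B , expand-isModel B B⊨T , to (holds-strip (λ _ → refl) φ) B⊨φ , fin

  -- Here the finite model `B` comes from the hypothesis on `T′`, so that its `s` is the identity
  -- follows from the added axiom and not from a construction.
  finiteModelProperty-reduct : ∀ {S} → FiniteModelProperty ℓ T′ S → FiniteModelProperty ℓ T S
  finiteModelProperty-reduct fmp φ qf (A , A⊨T , A⊨φ) =
    let B , B⊨T′ , B⊨φ , fin = fmp (embed φ) (embed-quantifierFree qf)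
          (expand A , expand-isModel A A⊨T , to (holds-embed (λ _ → refl) φ) A⊨φ)
    in reduct B , reduct-isModel B B⊨T′ , from (holds-embed (interpretsIdentity B B⊨T′) φ) B⊨φ , fin

  -- The model to be bounded is `reduct A`, whose domains are those of `A`, so the injections into
  -- them carry over together with finiteness.
  stablyFinite-expand : ∀ {S} → StablyFinite ℓ T S → StablyFinite ℓ T′ S
  stablyFinite-expand sf φ qf A A⊨T′ A⊨φ =
    let B , B⊨T , B⊨φ , fin = sf (strip φ) (strip-quantifierFree qf) (reduct A)
          (reduct-isModel A A⊨T′) (from (holds-strip (interpretsIdentity A A⊨T′) φ) A⊨φ)
    in expand B , expand-isModel B B⊨T , to (holds-strip (λ _ → refl) φ) B⊨φ , fin

  stablyFinite-reduct : ∀ {S} → StablyFinite ℓ T′ S → StablyFinite ℓ T S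
  stablyFinite-reduct sf φ qf A A⊨T A⊨φ =
    let B , B⊨T′ , B⊨φ , fin = sf (embed φ) (embed-quantifierFree qf) (expand A)
          (expand-isModel A A⊨T) (to (holds-embed (λ _ → refl) φ) A⊨φ)
    in reduct B , reduct-isModel B B⊨T′ , from (holds-embed (interpretsIdentity B B⊨T′) φ) B⊨φ , fin

theorem9 : (a ℓ : Level) (m : ℕ) (x : ℕ) (T : Theory (emptySignature (suc m)) a) →
    (FiniteModelProperty ℓ T U ⇔ FiniteModelProperty ℓ (addIdentity x T) U)
    × (StablyFinite ℓ T U ⇔ StablyFinite ℓ (addIdentity x T) U)
theorem9 a ℓ m x T =
  mk⇔ (finiteModelProperty-expand x T) (finiteModelProperty-reduct x T) ,
  mk⇔ (stablyFinite-expand x T) (stablyFinite-reduct x T)
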